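{- For every positive integer $n>2$ there is a prime number $p$ with $4n<p<5n$. -}

module Defs where

{-# OPTIONS --safe #-}
module Submission where

open import Defs
open import Data.Bool.Base using (Bool; true; T; _∧_; not; if_then_else_)
open import Data.Bool.Properties using (T-∧)
open import Data.Empty using (⊥; ⊥-elim)
open import Data.List.Base using (List; []; _∷_; _++_; map; concatMap; downFrom)
open import Data.List.Properties using (map-++)
open import Data.List.Relation.Binary.Permutation.Propositional.Properties using (map⁺)
open import Data.List.Relation.Binary.Pointwise using (Pointwise; []; _∷_; decidable)
open import Data.List.Relation.Unary.All using (All; []; _∷_)
open import Data.Nat
open import Data.Nat.Coprimality using (Coprime; coprime-divisor)
open import Data.Nat.Divisibility
open import Data.Nat.DivMod
open import Data.Nat.Induction using (<-rec)
open import Data.Nat.ListAction using (sum; product)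
open import Data.Nat.ListAction.Properties using (product-++; product-↭)
open import Data.Nat.Primality
open import Data.Nat.Primality.Factorisation using (PrimeFactorisation; factorise)
open import Data.Nat.Properties
open import Data.Nat.Tactic.RingSolver using (solve-∀)
open import Data.List.Sort.Base ≤-totalOrder using (SortingAlgorithm)
open import Data.List.Sort.InsertionSort ≤-decTotalOrder using (insertionSort)
open import Data.Product using (∃; _×_; _,_)
open import Data.Sum using (inj₁; inj₂)
open import Function.Base using (_∘_; _$_; case_of_)
open import Function.Bundles using (Equivalence)
open import Relation.Binary.PropositionalEquality
open import Relation.Nullary.Decidable using (Dec; yes; no; does; from-yes; _×-dec_; _→-dec_)
open import Relation.Nullary.Negation using (¬_; contradiction)

open SortingAlgorithm insertionSort using (sort; sort-↭)

-- Chebyshev's method.  With Ψ x the product of p over all prime powers p ^ k ≤ x,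
-- the quotient x ! ⌊x/30⌋ ! / (⌊x/2⌋ ! ⌊x/3⌋ ! ⌊x/5⌋ !) lies between Ψ x / Ψ (x/6) and
-- Ψ x, because ⌊y⌋ + ⌊y/30⌋ − ⌊y/2⌋ − ⌊y/3⌋ − ⌊y/5⌋ has period 30, takes only the
-- values 0 and 1, and is 1 for 1 ≤ y < 6.  For x = 30 m the quotient is α ^ m up to a
-- linear factor, with α = 2¹⁴ 3⁹ 5⁵ and 2 ^ 39.8 ≤ α ≤ 2 ^ 40.  Hence Ψ (30 m) ≥ α ^ m / (30 m + 1),
-- and descending from x to x/6 yields Ψ (30 m) ≤ 2 ^ (49 m + O(1)), where 49 > 40 · 6/5.
-- If there is no prime between 4 n and 5 n, then Ψ (5 n) ≤ Ψ (4 n) s ^ s with s = ⌊√(5 n)⌋; since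
-- 5 · 39.8 = 199 > 196 = 4 · 49, this is impossible for n ≥ 100000.  Below that bound
-- every n lies between p/5 and p/4 for one of 48 primes p.

-- Sums, products and indicators

∑ ∏ : ℕ → (ℕ → ℕ) → ℕ
∑ n f = sum (map f (downFrom n))
∏ n f = product (map f (downFrom n))

∑-mono : ∀ n {f g} → (∀ i → i < n → f i ≤ g i) → ∑ n f ≤ ∑ n g
∑-mono zero    f≤g = z≤n
∑-mono (suc n) f≤g = +-mono-≤ (f≤g n ≤-refl) (∑-mono n λ i i<n → f≤g i (m<n⇒m<1+n i<n))

∑-cong : ∀ n {f g} → (∀ i → f i ≡ g i) → ∑ n f ≡ ∑ n g
∑-cong zero    f≡g = refl
∑-cong (suc n) f≡g = cong₂ _+_ (f≡g n) (∑-cong n f≡g)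

∑-+ : ∀ n f g → ∑ n (λ i → f i + g i) ≡ ∑ n f + ∑ n g
∑-+ zero    f g = refl
∑-+ (suc n) f g = trans (cong ((f n + g n) +_) (∑-+ n f g)) (lemma (f n) (g n) _ _)
  where
  lemma : ∀ a b c d → (a + b) + (c + d) ≡ (a + c) + (b + d)
  lemma = solve-∀

∑-head : ∀ n f → ∑ (suc n) f ≡ f 0 + ∑ n (f ∘ suc)
∑-head zero    f = refl
∑-head (suc n) f = begin
  f (suc n) + ∑ (suc n) f              ≡⟨ cong (f (suc n) +_) (∑-head n f) ⟩
  f (suc n) + (f 0 + ∑ n (f ∘ suc))    ≡⟨ lemma (f (suc n)) (f 0) _ ⟩
  f 0 + (f (suc n) + ∑ n (f ∘ suc))    ∎
  where
  open ≡-Reasoning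
  lemma : ∀ a b c → a + (b + c) ≡ b + (a + c)
  lemma = solve-∀

∏-mono : ∀ n {f g} → (∀ i → i < n → f i ≤ g i) → ∏ n f ≤ ∏ n g
∏-mono zero    f≤g = ≤-refl
∏-mono (suc n) f≤g = *-mono-≤ (f≤g n ≤-refl) (∏-mono n λ i i<n → f≤g i (m<n⇒m<1+n i<n))

∏-cong : ∀ n {f g} → (∀ i → i < n → f i ≡ g i) → ∏ n f ≡ ∏ n g
∏-cong zero    f≡g = refl
∏-cong (suc n) f≡g = cong₂ _*_ (f≡g n ≤-refl) (∏-cong n λ i i<n → f≡g i (m<n⇒m<1+n i<n))

∏-* : ∀ n f g → ∏ n (λ i → f i * g i) ≡ ∏ n f * ∏ n g
∏-* zero    f g = refl
∏-* (suc n) f g = trans (cong ((f n * g n) *_) (∏-* n f g)) (lemma (f n) (g n) _ _)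
  where
  lemma : ∀ a b c d → (a * b) * (c * d) ≡ (a * c) * (b * d)
  lemma = solve-∀

∏-one : ∀ n {f} → (∀ i → i < n → f i ≡ 1) → ∏ n f ≡ 1
∏-one zero    f≡1 = refl
∏-one (suc n) f≡1 = cong₂ _*_ (f≡1 n ≤-refl) (∏-one n λ i i<n → f≡1 i (m<n⇒m<1+n i<n))

∏-single : ∀ n {f j} → j < n → (∀ i → i ≢ j → f i ≡ 1) → ∏ n f ≡ f j
∏-single (suc n) {f} {j} j<1+n f≡1 with m<1+n⇒m<n∨m≡n j<1+n
... | inj₁ j<n  = trans (cong₂ _*_ (f≡1 n (>⇒≢ j<n)) (∏-single n j<n f≡1)) (*-identityˡ (f j))
... | inj₂ refl = trans (cong (f n *_) (∏-one n λ i i<n → f≡1 i (<⇒≢ i<n))) (*-identityʳ (f n))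

-- Only the first `n ⊓ s` factors can exceed 1, and `c ≥ 1` allows the exponent to be raised from
-- `n ⊓ s` to `s`.
∏-≤-^ : ∀ n {f} s c .{{_ : NonZero c}} → (∀ i → i < s → f i ≤ c) → (∀ i → s ≤ i → f i ≤ 1) → ∏ n f ≤ c ^ s
∏-≤-^ n {f} s c f≤c f≤1 = ≤-trans (bound n) (^-monoʳ-≤ c (m⊓n≤n n s))
  where
  bound : ∀ n → ∏ n f ≤ c ^ (n ⊓ s)
  bound zero = ≤-refl
  bound (suc n) with n <? s
  ... | yes n<s = begin
    f n * ∏ n f      ≤⟨ *-mono-≤ (f≤c n n<s) (bound n) ⟩
    c * c ^ (n ⊓ s)  ≡⟨ cong (λ k → c * c ^ k) (m≤n⇒m⊓n≡m (<⇒≤ n<s)) ⟩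
    c ^ suc n        ≡⟨ cong (c ^_) (m≤n⇒m⊓n≡m n<s) ⟨
    c ^ (suc n ⊓ s)  ∎
    where open ≤-Reasoning
  ... | no n≮s = begin
    f n * ∏ n f      ≤⟨ *-mono-≤ (f≤1 n (≮⇒≥ n≮s)) (bound n) ⟩
    1 * c ^ (n ⊓ s)  ≡⟨ *-identityˡ _ ⟩
    c ^ (n ⊓ s)      ≤⟨ ^-monoʳ-≤ c (⊓-monoˡ-≤ s (n≤1+n n)) ⟩
    c ^ (suc n ⊓ s)  ∎
    where open ≤-Reasoning

𝟙 : ∀ {p} {P : Set p} → Dec P → ℕ
𝟙 P? = if does P? then 1 else 0

𝟙≤1 : ∀ {p} {P : Set p} (P? : Dec P) → 𝟙 P? ≤ 1
𝟙≤1 (yes _) = ≤-refl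
𝟙≤1 (no _)  = z≤n

𝟙-yes : ∀ {p} {P : Set p} (P? : Dec P) → P → 𝟙 P? ≡ 1
𝟙-yes (yes _) _ = refl
𝟙-yes (no ¬P) P = contradiction P ¬P

𝟙-no : ∀ {p} {P : Set p} (P? : Dec P) → ¬ P → 𝟙 P? ≡ 0
𝟙-no (yes P) ¬P = contradiction P ¬P
𝟙-no (no _)  _  = refl

𝟙-mono : ∀ {p q} {P : Set p} {Q : Set q} (P? : Dec P) (Q? : Dec Q) → (P → Q) → 𝟙 P? ≤ 𝟙 Q?
𝟙-mono (yes P) Q? f = ≤-reflexive (sym (𝟙-yes Q? (f P)))
𝟙-mono (no _)  Q? f = z≤n

𝟙-cong : ∀ {p q} {P : Set p} {Q : Set q} (P? : Dec P) (Q? : Dec Q) → (P → Q) → (Q → P) → 𝟙 P? ≡ 𝟙 Q?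
𝟙-cong P? Q? f g = ≤-antisym (𝟙-mono P? Q? f) (𝟙-mono Q? P? g)

-- The induction step of Legendre's formula: the floor jumps exactly when the remainder of `n` is
-- `d - 1`.
suc-/ : ∀ n d .{{_ : NonZero d}} → suc n / d ≡ n / d + 𝟙 (d ∣? suc n)
suc-/ n d with m<1+n⇒m<n∨m≡n (s≤s (m%n<n n d))
... | inj₁ 1+r<d = begin
  suc n / d                    ≡⟨ /-congˡ (cong suc (m≡m%n+[m/n]*n n d)) ⟩
  (suc r + q * d) / d          ≡⟨ +-distrib-/-∣ʳ (suc r) (n∣m*n q) ⟩
  suc r / d + q * d / d        ≡⟨ cong₂ _+_ (m<n⇒m/n≡0 1+r<d) (m*n/n≡m q d) ⟩
  q                            ≡⟨ +-identityʳ q ⟨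
  q + 0                        ≡⟨ cong (q +_) (𝟙-no (d ∣? suc n) d∤1+n) ⟨
  q + 𝟙 (d ∣? suc n)           ∎
  where
  open ≡-Reasoning
  r = n % d
  q = n / d
  d∤1+n : d ∤ suc n
  d∤1+n d∣1+n = >⇒∤ 1+r<d $ ∣m+n∣m⇒∣n
    (subst (d ∣_) (trans (cong suc (m≡m%n+[m/n]*n n d)) (+-comm (suc r) (q * d))) d∣1+n) (n∣m*n q)
... | inj₂ 1+r≡d = begin
  suc n / d                    ≡⟨ /-congˡ 1+n≡[1+q]d ⟩
  suc q * d / d                ≡⟨ m*n/n≡m (suc q) d ⟩
  suc q                        ≡⟨ +-comm 1 q ⟩
  q + 1                        ≡⟨ cong (q +_) (𝟙-yes (d ∣? suc n) (divides (suc q) 1+n≡[1+q]d)) ⟨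
  q + 𝟙 (d ∣? suc n)           ∎
  where
  open ≡-Reasoning
  q = n / d
  1+n≡[1+q]d : suc n ≡ suc q * d
  1+n≡[1+q]d = trans (cong suc (m≡m%n+[m/n]*n n d)) (cong (_+ q * d) 1+r≡d)

coprime-^ : ∀ {p q} k → Prime p → Prime q → p ≢ q → Coprime (q ^ k) p
coprime-^ {p} {q} k pp pq p≢q {c} (c∣qᵏ , c∣p) with prime⇒irreducible pp c∣p
... | inj₁ c≡1  = c≡1
... | inj₂ refl = contradiction (go k c∣qᵏ) p≢q
  where
  go : ∀ k → p ∣ q ^ k → p ≡ q
  go zero    p∣1 = contradiction (subst Prime (∣1⇒≡1 p∣1) pp) ¬prime[1]
  go (suc k) p∣  with euclidsLemma q (q ^ k) pp p∣
  ... | inj₂ p∣qᵏ = go k p∣qᵏ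
  ... | inj₁ p∣q with prime⇒irreducible pq p∣q
  ...   | inj₁ p≡1 = contradiction (subst Prime p≡1 pp) ¬prime[1]
  ...   | inj₂ p≡q = p≡q

n<m^n : ∀ {m} n → 1 < m → n < m ^ n
n<m^n zero    1<m = s≤s z≤n
n<m^n {m} (suc n) 1<m = begin
  2 + n          ≤⟨ +-monoʳ-≤ 1 (n<m^n n 1<m) ⟩
  1 + m ^ n      ≤⟨ +-monoˡ-≤ (m ^ n) (≤-trans (s≤s z≤n) (n<m^n n 1<m)) ⟩
  m ^ n + m ^ n  ≡⟨ cong (m ^ n +_) (+-identityʳ (m ^ n)) ⟨
  2 * m ^ n      ≤⟨ *-monoˡ-≤ (m ^ n) 1<m ⟩
  m * m ^ n      ∎
  where open ≤-Reasoning

prime⇒1< : ∀ {p} → Prime p → 1 < p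
prime⇒1< pp = nonTrivial⇒n>1 _ {{prime⇒nonTrivial pp}}

-- The default 1 lets products over primes be written as products over all indices.
base : ℕ → ℕ
base q = if does (prime? q) then q else 1

-- Factorials as products of prime powers

module PrimePowers (N : ℕ) where

  -- Indices start at 0: `i` stands for the base `suc i`, and `k` for the exponent `suc k`.
  row : (ℕ → ℕ) → ℕ → ℕ
  row e i = base (suc i) ^ ∑ N (λ k → e (suc i ^ suc k))

  -- W e is the product of p ^ e (p ^ k) over the primes p ≤ N and 1 ≤ k ≤ N.
  W : (ℕ → ℕ) → ℕ
  W e = ∏ N (row e)

  row-prime : ∀ e i → Prime (suc i) → row e i ≡ suc i ^ ∑ N (λ k → e (suc i ^ suc k))
  row-prime e i pr with prime? (suc i)
  ... | yes _ = refl
  ... | no ¬p = contradiction pr ¬p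

  row-¬prime : ∀ e i → ¬ Prime (suc i) → row e i ≡ 1
  row-¬prime e i ¬pr with prime? (suc i)
  ... | yes p = contradiction p ¬pr
  ... | no _  = ^-zeroˡ (∑ N (λ k → e (suc i ^ suc k)))

  W-+ : ∀ e e′ → W (λ d → e d + e′ d) ≡ W e * W e′
  W-+ e e′ = trans (∏-cong N row-+) (∏-* N (row e) (row e′))
    where
    row-+ : ∀ i → i < N → row (λ d → e d + e′ d) i ≡ row e i * row e′ i
    row-+ i _ = trans
      (cong (base (suc i) ^_) (∑-+ N (λ k → e (suc i ^ suc k)) (λ k → e′ (suc i ^ suc k))))
      (^-distribˡ-+-* (base (suc i)) (∑ N (λ k → e (suc i ^ suc k))) _)

  -- Inequalities between such products reduce to pointwise ones between exponents. Only `d > 1`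
  -- matters, as `e` is read in prime rows at proper prime powers.
  W-mono : ∀ e e′ → (∀ d → 1 < d → e d ≤ e′ d) → W e ≤ W e′
  W-mono e e′ e≤e′ = ∏-mono N λ i _ → row-mono i (prime? (suc i))
    where
    open ≤-Reasoning
    row-mono : ∀ i → Dec (Prime (suc i)) → row e i ≤ row e′ i
    row-mono i (no ¬p) = ≤-reflexive (trans (row-¬prime e i ¬p) (sym (row-¬prime e′ i ¬p)))
    row-mono i (yes p) = begin
      row e i                                    ≡⟨ row-prime e i p ⟩
      suc i ^ ∑ N (λ k → e (suc i ^ suc k))      ≤⟨ ^-monoʳ-≤ (suc i) (∑-mono N λ k _ →
        e≤e′ (suc i ^ suc k) (≤-<-trans (s≤s z≤n) (n<m^n (suc k) (prime⇒1< p)))) ⟩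
      suc i ^ ∑ N (λ k → e′ (suc i ^ suc k))     ≡⟨ row-prime e′ i p ⟨
      row e′ i                                   ∎

  W-cong : ∀ e e′ → (∀ d → 1 < d → e d ≡ e′ d) → W e ≡ W e′
  W-cong e e′ e≡e′ = ≤-antisym (W-mono e e′ λ d 1<d → ≤-reflexive (e≡e′ d 1<d))
                               (W-mono e′ e λ d 1<d → ≤-reflexive (sym (e≡e′ d 1<d)))

  W-one : ∀ e → (∀ d → 1 < d → e d ≡ 0) → W e ≡ 1
  W-one e e≡0 = trans (W-cong e (λ _ → 0) e≡0)
    (∏-one N λ i _ → cong (base (suc i) ^_) (∑-zero N))
    where
    ∑-zero : ∀ n → ∑ n (λ _ → 0) ≡ 0
    ∑-zero zero    = refl
    ∑-zero (suc n) = ∑-zero n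

  divisors : ℕ → ℕ → ℕ
  divisors n d = 𝟙 (d ∣? n)

  -- Since p ^ (k + 1) divides p m iff p ^ k divides m, the sum of indicators shifts by one place.
  -- It gains the term for p ^ 0, which is 1, and loses the one for p ^ N, which is 0 because m ≤ N
  -- < p ^ N.
  row-p : ∀ i m .{{_ : NonZero m}} → Prime (suc i) → m ≤ N →
          row (divisors (suc i * m)) i ≡ suc i * row (divisors m) i
  row-p i m pr m≤N = begin
    row (divisors (p * m)) i                     ≡⟨ row-prime (divisors (p * m)) i pr ⟩
    p ^ ∑ N (λ k → 𝟙 (p ^ suc k ∣? p * m))       ≡⟨ cong (p ^_) (∑-cong N λ k →
      𝟙-cong (p ^ suc k ∣? p * m) (p ^ k ∣? m) (*-cancelˡ-∣ p) (*-monoʳ-∣ p)) ⟩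
    p ^ ∑ N a                                    ≡⟨ cong (λ x → p ^ (x + ∑ N a)) (𝟙-no (p ^ N ∣? m) pᴺ∤m) ⟨
    p ^ ∑ (suc N) a                              ≡⟨ cong (p ^_) (∑-head N a) ⟩
    p ^ (a 0 + ∑ N (a ∘ suc))                    ≡⟨ cong (λ x → p ^ (x + ∑ N (a ∘ suc))) (𝟙-yes (1 ∣? m) (1∣ m)) ⟩
    p * p ^ ∑ N (a ∘ suc)                        ≡⟨ cong (p *_) (row-prime (divisors m) i pr) ⟨
    p * row (divisors m) i                       ∎
    where
    open ≡-Reasoning
    p = suc i
    a : ℕ → ℕ
    a k = 𝟙 (p ^ k ∣? m)
    pᴺ∤m : p ^ N ∤ m
    pᴺ∤m = >⇒∤ (≤-<-trans m≤N (n<m^n N (prime⇒1< pr)))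

  row-≢p : ∀ i p m → Prime p → suc i ≢ p → row (divisors (p * m)) i ≡ row (divisors m) i
  row-≢p i p m pp q≢p with prime? (suc i)
  ... | no _   = trans (^-zeroˡ (∑ N (λ k → 𝟙 (suc i ^ suc k ∣? p * m))))
                       (sym (^-zeroˡ (∑ N (λ k → 𝟙 (suc i ^ suc k ∣? m)))))
  ... | yes pr = cong (suc i ^_) (∑-cong N λ k →
    𝟙-cong (suc i ^ suc k ∣? p * m) (suc i ^ suc k ∣? m)
      (coprime-divisor (coprime-^ (suc k) pp pr (q≢p ∘ sym))) (∣n⇒∣m*n p))

  W-p* : ∀ p m .{{_ : NonZero m}} → Prime p → p ≤ N → m ≤ N → W (divisors (p * m)) ≡ p * W (divisors m)
  W-p* zero    m pp _ _ = contradiction pp ¬prime[0]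
  W-p* (suc j) m pp p≤N m≤N = begin
    ∏ N (row (divisors (p * m)))                     ≡⟨ ∏-cong N step ⟩
    ∏ N (λ i → δ i * row (divisors m) i)             ≡⟨ ∏-* N δ _ ⟩
    ∏ N δ * W (divisors m)                           ≡⟨ cong (_* W (divisors m)) (∏-single N p≤N δ≡1) ⟩
    δ j * W (divisors m)                             ≡⟨ cong (_* W (divisors m)) δ≡p ⟩
    p * W (divisors m)                               ∎
    where
    open ≡-Reasoning
    p = suc j
    -- Passing from `m` to `p * m` changes only row `j`, by one factor `p`; `δ` spreads that factor
    -- over all rows.
    δ : ℕ → ℕ
    δ i = p ^ 𝟙 (i ≟ j)
    δ≡1 : ∀ i → i ≢ j → δ i ≡ 1
    δ≡1 i i≢j = cong (p ^_) (𝟙-no (i ≟ j) i≢j)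
    δ≡p : δ j ≡ p
    δ≡p = trans (cong (p ^_) (𝟙-yes (j ≟ j) refl)) (*-identityʳ p)
    step : ∀ i → i < N → row (divisors (p * m)) i ≡ δ i * row (divisors m) i
    step i _ = case i ≟ j of λ where
      (yes refl) → trans (row-p i m pp m≤N) (cong (_* row (divisors m) i) (sym δ≡p))
      (no i≢j)   → begin
        row (divisors (p * m)) i    ≡⟨ row-≢p i p m pp (i≢j ∘ suc-injective) ⟩
        row (divisors m) i          ≡⟨ *-identityˡ _ ⟨
        1 * row (divisors m) i      ≡⟨ cong (_* row (divisors m) i) (δ≡1 i i≢j) ⟨
        δ i * row (divisors m) i    ∎

  -- The powers of a prime that divide `n` are counted by its valuation, so this is the prime
  -- factorisation of `n`; the induction runs along the list of prime factors.
  W-divisors : ∀ n .{{_ : NonZero n}} → n ≤ N → W (divisors n) ≡ n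
  W-divisors n n≤N = subst (λ m → W (divisors m) ≡ m) (sym isFactorisation)
      (go factors factorsPrime (subst (_≤ N) isFactorisation n≤N))
    where
    open PrimeFactorisation (factorise n)
    one : W (divisors 1) ≡ 1
    one = W-one (divisors 1) λ d 1<d → 𝟙-no (d ∣? 1) (>⇒∤ 1<d)
    go : ∀ ps → All Prime ps → product ps ≤ N → W (divisors (product ps)) ≡ product ps
    go []       []         _    = one
    go (p ∷ ps) (pp ∷ pps) ∏≤N = trans (W-p* p (product ps) pp p≤N m≤N) (cong (p *_) (go ps pps m≤N))
      where
      instance
        _ = productOfPrimes≢0 pps
        _ = prime⇒nonZero pp
      p≤N = ≤-trans (m≤m*n p (product ps)) ∏≤N
      m≤N = ≤-trans (m≤n*m (product ps) p) ∏≤N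

  -- The value at 0 is a default that makes the function total; `W` never reads it.
  quot : ℕ → ℕ → ℕ
  quot n zero    = 0
  quot n (suc d) = n / suc d

  -- Legendre's formula for the prime exponents of a factorial, obtained by adding the factorisation
  -- of each new factor `suc n`.
  W-quot : ∀ n → n ≤ N → W (quot n) ≡ n !
  W-quot zero    _     = W-one (quot 0) λ where (suc d) _ → 0/n≡0 (suc d)
  W-quot (suc n) 1+n≤N = begin
    W (quot (suc n))                            ≡⟨ W-cong (quot (suc n)) (λ d → quot n d + divisors (suc n) d) (λ where (suc d) _ → suc-/ n (suc d)) ⟩
    W (λ d → quot n d + divisors (suc n) d)     ≡⟨ W-+ (quot n) (divisors (suc n)) ⟩
    W (quot n) * W (divisors (suc n))           ≡⟨ cong₂ _*_ (W-quot n (<⇒≤ 1+n≤N)) (W-divisors (suc n) 1+n≤N) ⟩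
    n ! * suc n                                 ≡⟨ *-comm (n !) (suc n) ⟩
    suc n !                                     ∎
    where open ≡-Reasoning

-- Chebyshev's function

/-/-comm : ∀ m n o .{{_ : NonZero n}} .{{_ : NonZero o}} → m / n / o ≡ m / o / n
/-/-comm m n o = begin
  m / n / o    ≡⟨ m/n/o≡m/[n*o] m n o ⟩
  m / (n * o)  ≡⟨ /-congʳ (*-comm n o) ⟩
  m / (o * n)  ≡⟨ m/n/o≡m/[n*o] m o n ⟨
  m / o / n    ∎
  where
  open ≡-Reasoning
  instance
    _ = m*n≢0 n o
    _ = m*n≢0 o n

-- With y = ⌊x/d⌋, this and `floorsNum` are what a prime power d contributes to the exponents of the
-- denominator and numerator of Chebyshev's quotient.
floorsDen : ℕ → ℕ
floorsDen y = y / 2 + y / 3 + y / 5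

floorsNum : ℕ → ℕ
floorsNum y = y + y / 30

[m+k*n]/n : ∀ m k n .{{_ : NonZero n}} → (m + k * n) / n ≡ m / n + k
[m+k*n]/n m k n = trans (+-distrib-/-∣ʳ m (n∣m*n k)) (cong (m / n +_) (m*n/n≡m k n))

-- Both floor sums grow by 31 over a period of 30, here as 15 + 10 + 6 and for `floorsNum` as 30 +
-- 1. Hence their difference is periodic and can be checked on 30 residues.
floorsDen-+30 : ∀ r t → floorsDen (r + t * 30) ≡ floorsDen r + t * 31
floorsDen-+30 r t = begin
  floorsDen (r + t * 30)                                  ≡⟨ cong₂ _+_ (cong₂ _+_ (div 15 2) (div 10 3)) (div 6 5) ⟩
  (r / 2 + t * 15 + (r / 3 + t * 10)) + (r / 5 + t * 6)  ≡⟨ lemma (r / 2) (r / 3) (r / 5) t ⟩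
  floorsDen r + t * 31                                    ∎
  where
  open ≡-Reasoning
  div : ∀ k c .{{_ : NonZero c}} → (r + t * (k * c)) / c ≡ r / c + t * k
  div k c = trans (/-congˡ (cong (r +_) (sym (*-assoc t k c)))) ([m+k*n]/n r (t * k) c)
  lemma : ∀ a b c t → (a + t * 15 + (b + t * 10)) + (c + t * 6) ≡ a + b + c + t * 31
  lemma = solve-∀

floorsNum-+30 : ∀ r t → floorsNum (r + t * 30) ≡ floorsNum r + t * 31
floorsNum-+30 r t = trans (cong (r + t * 30 +_) ([m+k*n]/n r t 30)) (lemma r (r / 30) t)
  where
  lemma : ∀ a b t → a + t * 30 + (b + t) ≡ a + b + t * 31
  lemma = solve-∀

floorsNum≤1+floorsDen : ∀ y → floorsNum y ≤ 1 + floorsDen y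
floorsNum≤1+floorsDen y = begin
  floorsNum y                        ≡⟨ cong floorsNum (m≡m%n+[m/n]*n y 30) ⟩
  floorsNum (r + t * 30)             ≡⟨ floorsNum-+30 r t ⟩
  floorsNum r + t * 31               ≤⟨ +-monoˡ-≤ (t * 31)
    (from-yes (allUpTo? (λ r → floorsNum r ≤? 1 + floorsDen r) 30) (m%n<n y 30)) ⟩
  1 + floorsDen r + t * 31           ≡⟨ cong suc (floorsDen-+30 r t) ⟨
  1 + floorsDen (r + t * 30)         ≡⟨ cong (suc ∘ floorsDen) (m≡m%n+[m/n]*n y 30) ⟨
  1 + floorsDen y                    ∎
  where
  open ≤-Reasoning
  r = y % 30
  t = y / 30

floorsDen≤floorsNum : ∀ y → floorsDen y ≤ floorsNum y
floorsDen≤floorsNum y = begin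
  floorsDen y                        ≡⟨ cong floorsDen (m≡m%n+[m/n]*n y 30) ⟩
  floorsDen (r + t * 30)             ≡⟨ floorsDen-+30 r t ⟩
  floorsDen r + t * 31               ≤⟨ +-monoˡ-≤ (t * 31)
    (from-yes (allUpTo? (λ r → floorsDen r ≤? floorsNum r) 30) (m%n<n y 30)) ⟩
  floorsNum r + t * 31               ≡⟨ floorsNum-+30 r t ⟨
  floorsNum (r + t * 30)             ≡⟨ cong floorsNum (m≡m%n+[m/n]*n y 30) ⟨
  floorsNum y                        ∎
  where
  open ≤-Reasoning
  r = y % 30
  t = y / 30

-- These `y` are the values of ⌊x/d⌋ for x/6 < d ≤ x, the prime powers that separate Ψ x from Ψ
-- (x/6).
floorsDen<floorsNum : ∀ {y} → y < 6 → 1 ≤ y → 1 + floorsDen y ≤ floorsNum y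
floorsDen<floorsNum = from-yes (allUpTo? (λ y → 1 ≤? y →-dec 1 + floorsDen y ≤? floorsNum y) 6)

module Chebyshev (N : ℕ) where
  open PrimePowers N public

  upTo : ℕ → ℕ → ℕ
  upTo x d = 𝟙 (d ≤? x)

  -- Ψ = exp ∘ ψ for Chebyshev's function ψ.
  Ψ : ℕ → ℕ
  Ψ x = W (upTo x)

  Ψ-mono : ∀ {x y} → x ≤ y → Ψ x ≤ Ψ y
  Ψ-mono {x} {y} x≤y = W-mono (upTo x) (upTo y) λ d _ → 𝟙-mono (d ≤? x) (d ≤? y) (λ d≤x → ≤-trans d≤x x≤y)

  Ψ1≡1 : Ψ 1 ≡ 1
  Ψ1≡1 = W-one (upTo 1) λ d 1<d → 𝟙-no (d ≤? 1) (<⇒≱ 1<d)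

  quotDen quotNum : ℕ → ℕ → ℕ
  quotDen x d = quot (x / 2) d + quot (x / 3) d + quot (x / 5) d
  quotNum x d = quot x d + quot (x / 30) d

  quotDen≡ : ∀ x d → quotDen x (suc d) ≡ floorsDen (x / suc d)
  quotDen≡ x d = cong₂ _+_ (cong₂ _+_ (/-/-comm x 2 (suc d)) (/-/-comm x 3 (suc d))) (/-/-comm x 5 (suc d))

  quotNum≡ : ∀ x d → quotNum x (suc d) ≡ floorsNum (x / suc d)
  quotNum≡ x d = cong (x / suc d +_) (/-/-comm x 30 (suc d))

  W-quotDen : ∀ x → x ≤ N → W (quotDen x) ≡ (x / 2) ! * (x / 3) ! * (x / 5) !
  W-quotDen x x≤N = begin
    W (quotDen x)                                          ≡⟨ W-+ (λ d → quot (x / 2) d + quot (x / 3) d) (quot (x / 5)) ⟩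
    W (λ d → quot (x / 2) d + quot (x / 3) d) * W (quot (x / 5)) ≡⟨ cong (_* W (quot (x / 5))) (W-+ (quot (x / 2)) (quot (x / 3))) ⟩
    W (quot (x / 2)) * W (quot (x / 3)) * W (quot (x / 5))    ≡⟨ cong₂ _*_ (cong₂ _*_ (fac 2) (fac 3)) (fac 5) ⟩
    (x / 2) ! * (x / 3) ! * (x / 5) !                         ∎
    where
    open ≡-Reasoning
    fac : ∀ c .{{_ : NonZero c}} → W (quot (x / c)) ≡ (x / c) !
    fac c = W-quot (x / c) (≤-trans (m/n≤m x c) x≤N)

  W-quotNum : ∀ x → x ≤ N → W (quotNum x) ≡ x ! * (x / 30) !
  W-quotNum x x≤N = trans (W-+ (quot x) (quot (x / 30)))
    (cong₂ _*_ (W-quot x x≤N) (W-quot (x / 30) (≤-trans (m/n≤m x 30) x≤N)))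

  -- Each prime power d ≤ x contributes at most 1 more to the numerator than to the denominator; for
  -- d > x the numerator gets nothing.
  factorials≤Ψ : ∀ x → x ≤ N → x ! * (x / 30) ! ≤ (x / 2) ! * (x / 3) ! * (x / 5) ! * Ψ x
  factorials≤Ψ x x≤N = begin
    x ! * (x / 30) !                              ≡⟨ W-quotNum x x≤N ⟨
    W (quotNum x)                              ≤⟨ W-mono (quotNum x) (λ d → quotDen x d + upTo x d) pointwise ⟩
    W (λ d → quotDen x d + upTo x d)           ≡⟨ W-+ (quotDen x) (upTo x) ⟩
    W (quotDen x) * Ψ x                        ≡⟨ cong (_* Ψ x) (W-quotDen x x≤N) ⟩
    (x / 2) ! * (x / 3) ! * (x / 5) ! * Ψ x       ∎
    where
    open ≤-Reasoning
    pointwise : ∀ d → 1 < d → quotNum x d ≤ quotDen x d + upTo x d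
    pointwise d@(suc d-1) _ = case d ≤? x of λ where
      (yes d≤x) → begin
        quotNum x d             ≡⟨ quotNum≡ x d-1 ⟩
        floorsNum (x / d)             ≤⟨ floorsNum≤1+floorsDen (x / d) ⟩
        1 + floorsDen (x / d)         ≡⟨ +-comm 1 _ ⟩
        floorsDen (x / d) + 1         ≡⟨ cong₂ _+_ (quotDen≡ x d-1) (𝟙-yes (d ≤? x) d≤x) ⟨
        quotDen x d + upTo x d  ∎
      (no d≰x) → begin
        quotNum x d             ≡⟨ quotNum≡ x d-1 ⟩
        floorsNum (x / d)             ≡⟨ cong floorsNum (m<n⇒m/n≡0 (≰⇒> d≰x)) ⟩
        0                          ≤⟨ z≤n ⟩
        quotDen x d + upTo x d  ∎

  -- Prime powers d in (x/6, x] are paid for by the surplus of the numerator, where ⌊x/d⌋ is between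
  -- 1 and 5. Those up to x/6 are paid for by Ψ (x/6).
  Ψ≤factorials : ∀ x → x ≤ N → Ψ x * ((x / 2) ! * (x / 3) ! * (x / 5) !) ≤ Ψ (x / 6) * (x ! * (x / 30) !)
  Ψ≤factorials x x≤N = begin
    Ψ x * ((x / 2) ! * (x / 3) ! * (x / 5) !)        ≡⟨ cong (Ψ x *_) (W-quotDen x x≤N) ⟨
    Ψ x * W (quotDen x)                           ≡⟨ W-+ (upTo x) (quotDen x) ⟨
    W (λ d → upTo x d + quotDen x d)              ≤⟨ W-mono (λ d → upTo x d + quotDen x d) _ pointwise ⟩
    W (λ d → upTo (x / 6) d + quotNum x d)        ≡⟨ W-+ (upTo (x / 6)) (quotNum x) ⟩
    Ψ (x / 6) * W (quotNum x)                     ≡⟨ cong (Ψ (x / 6) *_) (W-quotNum x x≤N) ⟩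
    Ψ (x / 6) * (x ! * (x / 30) !)                   ∎
    where
    open ≤-Reasoning
    x/d<6 : ∀ d .{{_ : NonZero d}} → ¬ (d ≤ x / 6) → x / d < 6
    x/d<6 d d≰x/6 = m<n*o⇒m/o<n (≰⇒> λ 6d≤x → d≰x/6
      (subst (_≤ x / 6) (m*n/n≡m d 6) (/-monoˡ-≤ 6 (subst (_≤ x) (*-comm 6 d) 6d≤x))))
    pointwise : ∀ d → 1 < d → upTo x d + quotDen x d ≤ upTo (x / 6) d + quotNum x d
    pointwise d@(suc d-1) _ = case d ≤? x / 6 of λ where
      (yes d≤x/6) → begin
        upTo x d + quotDen x d          ≤⟨ +-mono-≤ (𝟙≤1 (d ≤? x)) (≤-reflexive (quotDen≡ x d-1)) ⟩
        1 + floorsDen (x / d)                 ≤⟨ +-monoʳ-≤ 1 (floorsDen≤floorsNum (x / d)) ⟩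
        1 + floorsNum (x / d)                 ≡⟨ cong₂ _+_ (𝟙-yes (d ≤? x / 6) d≤x/6) (quotNum≡ x d-1) ⟨
        upTo (x / 6) d + quotNum x d    ∎
      (no d≰x/6) → case d ≤? x of λ where
        (yes d≤x) → begin
          upTo x d + quotDen x d        ≡⟨ cong₂ _+_ (𝟙-yes (d ≤? x) d≤x) (quotDen≡ x d-1) ⟩
          1 + floorsDen (x / d)               ≤⟨ floorsDen<floorsNum (x/d<6 d d≰x/6) (m≥n⇒m/n>0 d≤x) ⟩
          floorsNum (x / d)                   ≡⟨ quotNum≡ x d-1 ⟨
          quotNum x d                   ≤⟨ m≤n+m (quotNum x d) (upTo (x / 6) d) ⟩
          upTo (x / 6) d + quotNum x d  ∎
        (no d≰x) → begin
          upTo x d + quotDen x d        ≡⟨ cong₂ _+_ (𝟙-no (d ≤? x) d≰x) (quotDen≡ x d-1) ⟩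
          floorsDen (x / d)                   ≤⟨ floorsDen≤floorsNum (x / d) ⟩
          floorsNum (x / d)                   ≡⟨ quotNum≡ x d-1 ⟨
          quotNum x d                   ≤⟨ m≤n+m (quotNum x d) (upTo (x / 6) d) ⟩
          upTo (x / 6) d + quotNum x d  ∎

  -- A prime q with q² > x enters Ψ x only to the first power, and then q ≤ y. If q² ≤ x, then q ^
  -- (k + 2) ≤ x ≤ 2 y forces q ^ (k + 1) ≤ y, so at most one extra factor q arises. The extra
  -- factors, collected in `big`, are at most `s` each and `s` in number.
  Ψ-primeless : ∀ x y s → x ≤ 2 * y → (∀ q → q * q ≤ x → q ≤ s) → .{{NonZero s}} →
                (∀ {p} → Prime p → p ≤ x → p ≤ y) → Ψ x ≤ Ψ y * s ^ s
  Ψ-primeless x y s x≤2y q≤s primeless = begin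
    Ψ x                                  ≤⟨ ∏-mono N (λ i _ → row-bound i (prime? (suc i)) (suc i * suc i ≤? x)) ⟩
    ∏ N (λ i → row (upTo y) i * big i)   ≡⟨ ∏-* N (row (upTo y)) big ⟩
    Ψ y * ∏ N big                        ≤⟨ *-monoʳ-≤ (Ψ y) (∏-≤-^ N s s big≤s big≤1) ⟩
    Ψ y * s ^ s                          ∎
    where
    open ≤-Reasoning
    big : ℕ → ℕ
    big i = suc i ^ 𝟙 (suc i * suc i ≤? x)
    big≤s : ∀ i → i < s → big i ≤ s
    big≤s i i<s = begin
      big i        ≤⟨ ^-monoʳ-≤ (suc i) (𝟙≤1 (suc i * suc i ≤? x)) ⟩
      suc i ^ 1    ≡⟨ *-identityʳ (suc i) ⟩
      suc i        ≤⟨ i<s ⟩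
      s            ∎
    big≤1 : ∀ i → s ≤ i → big i ≤ 1
    big≤1 i s≤i = ≤-reflexive (cong (suc i ^_) (𝟙-no (suc i * suc i ≤? x) λ q²≤x → ≤⇒≯ s≤i (q≤s (suc i) q²≤x)))
    b : ℕ → ℕ → ℕ → ℕ
    b x i k = upTo x (suc i ^ suc k)
    small : ∀ i k → Prime (suc i) → ¬ (suc i * suc i ≤ x) → b x i k ≤ b y i k
    small i k pr q²≰x = 𝟙-mono (suc i ^ suc k ≤? x) (suc i ^ suc k ≤? y) (power k)
      where
      power : ∀ k → suc i ^ suc k ≤ x → suc i ^ suc k ≤ y
      power zero q≤x = subst (_≤ y) (sym (*-identityʳ (suc i))) (primeless pr (subst (_≤ x) (*-identityʳ (suc i)) q≤x))
      power (suc k) qᵏ≤x = contradiction (≤-trans (*-monoʳ-≤ (suc i) (m≤m*n (suc i) (suc i ^ k) {{m^n≢0 (suc i) k}})) qᵏ≤x) q²≰x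
    exponent : ∀ i → Prime (suc i) → Dec (suc i * suc i ≤ x) → ∑ N (b x i) ≤ ∑ N (b y i) + 𝟙 (suc i * suc i ≤? x)
    exponent i pr (no q²≰x) = ≤-trans (∑-mono N λ k _ → small i k pr q²≰x) (m≤m+n _ _)
    exponent i pr (yes q²≤x) = begin
      -- A further term at the end leaves `N` terms once the first power has been split off,
      -- matching the sum for `y`.
      ∑ N (b x i)                               ≤⟨ m≤n+m _ _ ⟩
      ∑ (suc N) (b x i)                         ≡⟨ ∑-head N (b x i) ⟩
      b x i 0 + ∑ N (b x i ∘ suc)               ≤⟨ +-mono-≤ (𝟙≤1 (suc i ^ 1 ≤? x)) (∑-mono N λ k _ →
        𝟙-mono (suc i ^ suc (suc k) ≤? x) (suc i ^ suc k ≤? y) λ qᵏ≤x →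
          *-cancelˡ-≤ 2 (≤-trans (*-monoˡ-≤ (suc i ^ suc k) (prime⇒1< pr)) (≤-trans qᵏ≤x x≤2y))) ⟩
      1 + ∑ N (b y i)                           ≡⟨ +-comm 1 _ ⟩
      ∑ N (b y i) + 1                           ≡⟨ cong (∑ N (b y i) +_) (𝟙-yes (suc i * suc i ≤? x) q²≤x) ⟨
      ∑ N (b y i) + 𝟙 (suc i * suc i ≤? x)      ∎
    row-bound : ∀ i → Dec (Prime (suc i)) → Dec (suc i * suc i ≤ x) → row (upTo x) i ≤ row (upTo y) i * big i
    row-bound i (no ¬p) _ = begin
      row (upTo x) i          ≡⟨ row-¬prime (upTo x) i ¬p ⟩
      1                       ≤⟨ m^n>0 (suc i) (𝟙 (suc i * suc i ≤? x)) ⟩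
      big i                   ≡⟨ *-identityˡ (big i) ⟨
      1 * big i               ≡⟨ cong (_* big i) (row-¬prime (upTo y) i ¬p) ⟨
      row (upTo y) i * big i  ∎
    row-bound i (yes p) q²≤?x = begin
      row (upTo x) i                                      ≡⟨ row-prime (upTo x) i p ⟩
      suc i ^ ∑ N (b x i)                                 ≤⟨ ^-monoʳ-≤ (suc i) (exponent i p q²≤?x) ⟩
      suc i ^ (∑ N (b y i) + 𝟙 (suc i * suc i ≤? x))      ≡⟨ ^-distribˡ-+-* (suc i) (∑ N (b y i)) _ ⟩
      suc i ^ ∑ N (b y i) * big i                         ≡⟨ cong (_* big i) (row-prime (upTo y) i p) ⟨
      row (upTo y) i * big i                              ∎

-- Growth of factorial quotients

product-map-+-mono : ∀ x {ms ns} → Pointwise _≤_ ms ns → product (map (x +_) ms) ≤ product (map (x +_) ns)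
product-map-+-mono x []              = ≤-refl
product-map-+-mono x (m≤n ∷ ms≤ns) = *-mono-≤ (+-monoʳ-≤ x m≤n) (product-map-+-mono x ms≤ns)

-- Domination of the sorted lists gives the inequality for every `x` at once, and for concrete lists
-- it is decidable.
product-map-+-sort : ∀ x ms ns → Pointwise _≤_ (sort ms) (sort ns) → product (map (x +_) ms) ≤ product (map (x +_) ns)
product-map-+-sort x ms ns ms≤ns = begin
  product (map (x +_) ms)         ≡⟨ product-↭ (map⁺ (x +_) (sort-↭ ms)) ⟨
  product (map (x +_) (sort ms))  ≤⟨ product-map-+-mono x ms≤ns ⟩
  product (map (x +_) (sort ns))  ≡⟨ product-↭ (map⁺ (x +_) (sort-↭ ns)) ⟩
  product (map (x +_) ns)         ∎
  where open ≤-Reasoning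

multiples : ℕ → ℕ → List ℕ
multiples c k = map (λ i → c * suc i) (downFrom k)

-- Each of the `k` new factors a + i of the factorial absorbs one `c` and becomes c a + c i.
^*!-+ : ∀ c k a → c ^ k * (k + a) ! ≡ product (map (c * a +_) (multiples c k)) * a !
^*!-+ c zero    a = refl
^*!-+ c (suc k) a = begin
  c * c ^ k * (suc (k + a) * (k + a) !)      ≡⟨ lemma c (c ^ k) k a ((k + a) !) ⟩
  (c * a + c * suc k) * (c ^ k * (k + a) !)  ≡⟨ cong ((c * a + c * suc k) *_) (^*!-+ c k a) ⟩
  (c * a + c * suc k) * (P * a !)            ≡⟨ *-assoc (c * a + c * suc k) P (a !) ⟨
  (c * a + c * suc k) * P * a !              ∎
  where
  open ≡-Reasoning
  P = product (map (c * a +_) (multiples c k))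
  lemma : ∀ c d k a f → c * d * ((1 + (k + a)) * f) ≡ (c * a + c * (1 + k)) * (d * f)
  lemma = solve-∀

-- An entry `(c , k)` encodes the factorial `(m * k) !`. The cofactor `c`, with `c * k ≡ M`, later
-- brings the growth factors of all entries to the common form `m * M` plus a constant.
factorials : List (ℕ × ℕ) → ℕ → ℕ
factorials cks m = product (map (λ (_ , k) → (m * k) !) cks)

shifts : List (ℕ × ℕ) → List ℕ
shifts = concatMap λ (c , k) → multiples c k

scale : List (ℕ × ℕ) → ℕ
scale = product ∘ map λ (c , k) → c ^ k

factorials-suc : ∀ {M} cks → All (λ (c , k) → c * k ≡ M) cks → ∀ m →
  scale cks * factorials cks (suc m) ≡ product (map (m * M +_) (shifts cks)) * factorials cks m
factorials-suc []              []            m = refl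
factorials-suc {M} ((c , k) ∷ cks) (ck≡M ∷ eqs) m = begin
  c ^ k * S * ((k + m * k) ! * F)                                    ≡⟨ lemma₁ (c ^ k) S ((k + m * k) !) F ⟩
  c ^ k * (k + m * k) ! * (S * F)                                    ≡⟨ cong₂ _*_ (^*!-+ c k (m * k)) (factorials-suc cks eqs m) ⟩
  product (map (c * (m * k) +_) ms) * (m * k) ! * (P * F′)           ≡⟨ cong (λ x → product (map (x +_) ms) * (m * k) ! * (P * F′)) c[mk]≡mM ⟩
  product (map (m * M +_) ms) * (m * k) ! * (P * F′)                 ≡⟨ lemma₁ (product (map (m * M +_) ms)) ((m * k) !) P F′ ⟩
  product (map (m * M +_) ms) * P * ((m * k) ! * F′)                 ≡⟨ cong (_* ((m * k) ! * F′)) (product-++ (map (m * M +_) ms) _) ⟨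
  product (map (m * M +_) ms ++ map (m * M +_) (shifts cks)) * ((m * k) ! * F′) ≡⟨ cong (λ l → product l * ((m * k) ! * F′)) (map-++ (m * M +_) ms (shifts cks)) ⟨
  product (map (m * M +_) (ms ++ shifts cks)) * ((m * k) ! * F′)     ∎
  where
  open ≡-Reasoning
  S  = scale cks
  F  = factorials cks (suc m)
  F′ = factorials cks m
  P  = product (map (m * M +_) (shifts cks))
  ms = multiples c k
  lemma₁ : ∀ a b c d → a * b * (c * d) ≡ a * c * (b * d)
  lemma₁ = solve-∀
  c[mk]≡mM : c * (m * k) ≡ m * M
  c[mk]≡mM = trans (lemma₂ c m k) (cong (m *_) ck≡M)
    where
    lemma₂ : ∀ c m k → c * (m * k) ≡ m * (c * k)
    lemma₂ = solve-∀

-- A quotient of products of factorials (m * k) ! is compared with α ^ m by means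
-- of the factors by which both sides grow when m does.
module FactorialRatio
  {M} (num den : List (ℕ × ℕ)) (α : ℕ)
  (num-M : All (λ (c , k) → c * k ≡ M) num) (den-M : All (λ (c , k) → c * k ≡ M) den)
  .{{_ : NonZero (scale num)}} (scale≡ : α * scale num ≡ scale den)
  where

  open ≤-Reasoning

  private
    Fₙ Fᵈ Pₙ Pᵈ : ℕ → ℕ
    Fₙ = factorials num
    Fᵈ = factorials den
    Pₙ m = product (map (m * M +_) (shifts num))
    Pᵈ m = product (map (m * M +_) (shifts den))

    den-suc : ∀ m → scale num * (α ^ suc m * Fᵈ (suc m)) ≡ α ^ m * (Pᵈ m * Fᵈ m)
    den-suc m = begin-equality
      scale num * (α * α ^ m * Fᵈ (suc m))     ≡⟨ lemma (scale num) α (α ^ m) (Fᵈ (suc m)) ⟩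
      α ^ m * (α * scale num * Fᵈ (suc m))     ≡⟨ cong (λ s → α ^ m * (s * Fᵈ (suc m))) scale≡ ⟩
      α ^ m * (scale den * Fᵈ (suc m))         ≡⟨ cong (α ^ m *_) (factorials-suc den den-M m) ⟩
      α ^ m * (Pᵈ m * Fᵈ m)                    ∎
      where
      lemma : ∀ s a b f → s * (a * b * f) ≡ b * (a * s * f)
      lemma = solve-∀

  -- After clearing `scale num`, a step of `m` multiplies the two sides by the products over the
  -- shifted lists, which the hypothesis compares for every `m`.
  upper : Pointwise _≤_ (sort (shifts num)) (sort (shifts den)) →
          Fₙ 0 ≤ Fᵈ 0 → ∀ m → Fₙ m ≤ α ^ m * Fᵈ m
  upper n≤d F0 zero    = ≤-trans F0 (≤-reflexive (sym (*-identityˡ (Fᵈ 0))))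
  upper n≤d F0 (suc m) = *-cancelˡ-≤ (scale num) (begin
    scale num * Fₙ (suc m)                   ≡⟨ factorials-suc num num-M m ⟩
    Pₙ m * Fₙ m                              ≤⟨ *-mono-≤ (product-map-+-sort (m * M) (shifts num) (shifts den) n≤d) (upper n≤d F0 m) ⟩
    Pᵈ m * (α ^ m * Fᵈ m)                    ≡⟨ lemma (Pᵈ m) (α ^ m) (Fᵈ m) ⟩
    α ^ m * (Pᵈ m * Fᵈ m)                    ≡⟨ den-suc m ⟨
    scale num * (α ^ suc m * Fᵈ (suc m))     ∎)
    where
    lemma : ∀ p a f → p * (a * f) ≡ a * (p * f)
    lemma = solve-∀

  -- The reverse comparison needs the extra shifts 1 and `M`. Their ratios (m M + M) / (m M + 1)
  -- accumulate to no more than the linear factor.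
  lower : Pointwise _≤_ (sort (1 ∷ shifts den)) (sort (M ∷ shifts num)) →
          Fᵈ 0 ≤ Fₙ 0 → ∀ m → α ^ m * Fᵈ m ≤ (m * M + 1) * Fₙ m
  lower d≤n F0 zero    = *-monoʳ-≤ 1 F0
  lower d≤n F0 (suc m) = *-cancelˡ-≤ (scale num) (*-cancelˡ-≤ (m * M + 1) {{≢-nonZero (m+1+n≢0 (m * M))}} (begin
    (m * M + 1) * (scale num * (α ^ suc m * Fᵈ (suc m)))            ≡⟨ cong ((m * M + 1) *_) (den-suc m) ⟩
    (m * M + 1) * (α ^ m * (Pᵈ m * Fᵈ m))                           ≡⟨ lemma₁ (m * M + 1) (α ^ m) (Pᵈ m) (Fᵈ m) ⟩
    (m * M + 1) * Pᵈ m * (α ^ m * Fᵈ m)                             ≤⟨ *-mono-≤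
      (product-map-+-sort (m * M) (1 ∷ shifts den) (M ∷ shifts num) d≤n) (lower d≤n F0 m) ⟩
    (m * M + M) * Pₙ m * ((m * M + 1) * Fₙ m)                       ≡⟨ lemma₂ (m * M + M) (Pₙ m) (m * M + 1) (Fₙ m) ⟩
    (m * M + 1) * ((m * M + M) * (Pₙ m * Fₙ m))                     ≡⟨ cong (λ s → (m * M + 1) * ((m * M + M) * s)) (factorials-suc num num-M m) ⟨
    -- Weakening m M + M to (m + 1) M + 1 produces the linear factor for `suc m`.
    (m * M + 1) * ((m * M + M) * (scale num * Fₙ (suc m)))          ≤⟨ *-monoʳ-≤ (m * M + 1) (*-monoˡ-≤ (scale num * Fₙ (suc m)) (m≤m+n (m * M + M) 1)) ⟩
    (m * M + 1) * ((m * M + M + 1) * (scale num * Fₙ (suc m)))      ≡⟨ cong ((m * M + 1) *_) (lemma₃ (m * M) M (scale num) (Fₙ (suc m))) ⟩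
    (m * M + 1) * (scale num * ((M + m * M + 1) * Fₙ (suc m)))      ∎))
    where
    lemma₁ : ∀ x a p f → x * (a * (p * f)) ≡ x * p * (a * f)
    lemma₁ = solve-∀
    lemma₂ : ∀ y p x f → y * p * (x * f) ≡ x * (y * (p * f))
    lemma₂ = solve-∀
    lemma₃ : ∀ x M s f → (x + M + 1) * (s * f) ≡ s * ((M + x + 1) * f)
    lemma₃ = solve-∀

-- The constant of Chebyshev's quotient

chebyshevNum chebyshevDen : List (ℕ × ℕ)
chebyshevNum = (1 , 30) ∷ (30 , 1) ∷ []
chebyshevDen = (2 , 15) ∷ (3 , 10) ∷ (5 , 6) ∷ []

abstract
  -- The ratio of the two scales, 2¹⁵ 3¹⁰ 5⁶ / 30. It is abstract so that its powers are not
  -- evaluated.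
  α : ℕ
  α = 2 ^ 14 * 3 ^ 9 * 5 ^ 5

  α-scale : α * scale chebyshevNum ≡ scale chebyshevDen
  α-scale = refl

  α≤2^40 : α ≤ 2 ^ 40
  α≤2^40 = ≤ᵇ⇒≤ α (2 ^ 40) _

  -- The fifth power turns 39.8 into an integer and suits the later use of `α ^ (5 * t)`.
  2^199≤α^5 : 2 ^ 199 ≤ α ^ 5
  2^199≤α^5 = ≤ᵇ⇒≤ (2 ^ 199) (α ^ 5) _

open FactorialRatio chebyshevNum chebyshevDen α (refl ∷ refl ∷ []) (refl ∷ refl ∷ refl ∷ []) α-scale

num≤α^m*den : ∀ m → factorials chebyshevNum m ≤ α ^ m * factorials chebyshevDen m
num≤α^m*den = upper (from-yes (decidable _≤?_ (sort (shifts chebyshevNum)) (sort (shifts chebyshevDen)))) ≤-refl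

α^m*den≤num : ∀ m → α ^ m * factorials chebyshevDen m ≤ (m * 30 + 1) * factorials chebyshevNum m
α^m*den≤num = lower (from-yes (decidable _≤?_ (sort (1 ∷ shifts chebyshevDen)) (sort (30 ∷ shifts chebyshevNum)))) ≤-refl

-- Bounds for Ψ

factorials≢0 : ∀ m → NonZero (factorials chebyshevDen m)
factorials≢0 m = m*n≢0 _ _ {{(m * 15) !≢0}} {{m*n≢0 _ _ {{(m * 10) !≢0}} {{m*n≢0 _ 1 {{(m * 6) !≢0}}}}}}

module Estimates (N : ℕ) where
  open Chebyshev N

  open ≤-Reasoning

  private
    m*30/ : ∀ m k c .{{_ : NonZero c}} → m * (k * c) / c ≡ m * k
    m*30/ m k c = trans (/-congˡ (sym (*-assoc m k c))) (m*n/n≡m (m * k) c)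

    num≡ : ∀ m → (m * 30) ! * (m * 30 / 30) ! ≡ factorials chebyshevNum m
    num≡ m = cong ((m * 30) ! *_) (trans (cong _! (m*30/ m 1 30)) (sym (*-identityʳ ((m * 1) !))))

    den≡ : ∀ m → (m * 30 / 2) ! * (m * 30 / 3) ! * (m * 30 / 5) ! ≡ factorials chebyshevDen m
    den≡ m = trans (cong₂ _*_ (cong₂ _*_ (cong _! (m*30/ m 15 2)) (cong _! (m*30/ m 10 3))) (cong _! (m*30/ m 6 5)))
      (lemma ((m * 15) !) ((m * 10) !) ((m * 6) !))
      where
      lemma : ∀ a b c → a * b * c ≡ a * (b * (c * 1))
      lemma = solve-∀

  α^m≤Ψ : ∀ m → m * 30 ≤ N → α ^ m ≤ (m * 30 + 1) * Ψ (m * 30)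
  α^m≤Ψ m 30m≤N = *-cancelʳ-≤ _ _ D {{factorials≢0 m}} (begin
    α ^ m * D                                      ≤⟨ α^m*den≤num m ⟩
    (m * 30 + 1) * factorials chebyshevNum m       ≡⟨ cong ((m * 30 + 1) *_) (num≡ m) ⟨
    (m * 30 + 1) * ((m * 30) ! * (m * 30 / 30) !)  ≤⟨ *-monoʳ-≤ (m * 30 + 1) (factorials≤Ψ (m * 30) 30m≤N) ⟩
    (m * 30 + 1) * ((m * 30 / 2) ! * (m * 30 / 3) ! * (m * 30 / 5) ! * Ψ (m * 30))
                                                   ≡⟨ cong (λ d → (m * 30 + 1) * (d * Ψ (m * 30))) (den≡ m) ⟩
    (m * 30 + 1) * (D * Ψ (m * 30))                ≡⟨ lemma (m * 30 + 1) D (Ψ (m * 30)) ⟩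
    (m * 30 + 1) * Ψ (m * 30) * D                  ∎)
    where
    D = factorials chebyshevDen m
    lemma : ∀ a b c → a * (b * c) ≡ a * c * b
    lemma = solve-∀

  -- Combines `Ψ≤factorials` at x = 30 m with the upper bound for the factorial quotient.
  Ψ-descent : ∀ m → m * 30 ≤ N → Ψ (m * 30) ≤ 2 ^ (40 * m) * Ψ (m * 5)
  Ψ-descent m 30m≤N = begin
    Ψ (m * 30)               ≤⟨ *-cancelʳ-≤ _ _ D {{factorials≢0 m}} cancelled ⟩
    α ^ m * Ψ (m * 5)        ≤⟨ *-monoˡ-≤ (Ψ (m * 5)) (^-monoˡ-≤ m α≤2^40) ⟩
    (2 ^ 40) ^ m * Ψ (m * 5) ≡⟨ cong (_* Ψ (m * 5)) (^-*-assoc 2 40 m) ⟩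
    2 ^ (40 * m) * Ψ (m * 5) ∎
    where
    D = factorials chebyshevDen m
    lemma : ∀ p a d → p * (a * d) ≡ a * p * d
    lemma = solve-∀
    cancelled : Ψ (m * 30) * D ≤ α ^ m * Ψ (m * 5) * D
    cancelled = begin
      Ψ (m * 30) * D                                       ≡⟨ cong (Ψ (m * 30) *_) (den≡ m) ⟨
      Ψ (m * 30) * ((m * 30 / 2) ! * (m * 30 / 3) ! * (m * 30 / 5) !) ≤⟨ Ψ≤factorials (m * 30) 30m≤N ⟩
      Ψ (m * 30 / 6) * ((m * 30) ! * (m * 30 / 30) !)      ≡⟨ cong₂ _*_ (cong Ψ (m*30/ m 5 6)) (num≡ m) ⟩
      Ψ (m * 5) * factorials chebyshevNum m                ≤⟨ *-monoʳ-≤ (Ψ (m * 5)) (num≤α^m*den m) ⟩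
      Ψ (m * 5) * (α ^ m * D)                              ≡⟨ lemma (Ψ (m * 5)) (α ^ m) D ⟩
      α ^ m * Ψ (m * 5) * D                                ∎

  Ψ≤! : ∀ x → x ≤ N → Ψ x ≤ Ψ (x / 6) * (x ! * (x / 30) !)
  Ψ≤! x x≤N = ≤-trans (m≤m*n (Ψ x) _ {{m*n≢0 _ _ {{m*n≢0 _ _ {{(x / 2) !≢0}} {{(x / 3) !≢0}}}} {{(x / 5) !≢0}}}})
    (Ψ≤factorials x x≤N)

  Ψ10≤2^22 : 10 ≤ N → Ψ 10 ≤ 2 ^ 22
  Ψ10≤2^22 10≤N = begin
    Ψ 10                                     ≤⟨ Ψ≤! 10 10≤N ⟩
    Ψ (10 / 6) * (10 ! * (10 / 30) !)        ≤⟨ *-mono-≤ (≤-reflexive Ψ1≡1) (≤ᵇ⇒≤ (10 ! * (10 / 30) !) (2 ^ 22) _) ⟩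
    1 * 2 ^ 22                               ≡⟨ *-identityˡ (2 ^ 22) ⟩
    2 ^ 22                                   ∎

  ⌈_/6⌉ : ℕ → ℕ
  ⌈ m /6⌉ = (m + 5) / 6

  ⌈m/6⌉*6≤m+5 : ∀ m → ⌈ m /6⌉ * 6 ≤ m + 5
  ⌈m/6⌉*6≤m+5 m = m/n*n≤m (m + 5) 6

  m≤⌈m/6⌉*6 : ∀ m → m ≤ ⌈ m /6⌉ * 6
  m≤⌈m/6⌉*6 m = +-cancelʳ-≤ 5 m (⌈ m /6⌉ * 6) (begin
    m + 5                               ≡⟨ m≡m%n+[m/n]*n (m + 5) 6 ⟩
    (m + 5) % 6 + ⌈ m /6⌉ * 6           ≤⟨ +-monoˡ-≤ (⌈ m /6⌉ * 6) (s≤s⁻¹ (m%n<n (m + 5) 6)) ⟩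
    5 + ⌈ m /6⌉ * 6                     ≡⟨ +-comm 5 _ ⟩
    ⌈ m /6⌉ * 6 + 5                     ∎)

  -- Rounds `m * 5` up to a multiple of 30, so that the descent can be iterated.
  Ψ-descent′ : ∀ m → m * 30 ≤ N → Ψ (m * 30) ≤ 2 ^ (40 * m) * Ψ (⌈ m /6⌉ * 30)
  Ψ-descent′ m 30m≤N = ≤-trans (Ψ-descent m 30m≤N) (*-monoʳ-≤ (2 ^ (40 * m)) (Ψ-mono (begin
    m * 5               ≤⟨ *-monoˡ-≤ 5 (m≤⌈m/6⌉*6 m) ⟩
    ⌈ m /6⌉ * 6 * 5     ≡⟨ *-assoc ⌈ m /6⌉ 6 5 ⟩
    ⌈ m /6⌉ * 30        ∎)))

  -- A linear bound of slope b is inherited by m from ⌈ m /6⌉ as soon as 40 m + b ⌈ m /6⌉ ≤ b m.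
  Ψ-linear : ∀ m₀ b K → 2 ≤ m₀ → (∀ m → m₀ ≤ m → b * (m + 5) ≤ (b ∸ 40) * m * 6) → 40 ≤ b →
             (∀ m → m < m₀ → m * 30 ≤ N → Ψ (m * 30) ≤ 2 ^ (b * m + K)) →
             ∀ m → m * 30 ≤ N → Ψ (m * 30) ≤ 2 ^ (b * m + K)
  Ψ-linear m₀ b K 2≤m₀ slope 40≤b initial = <-rec _ step
    where
    ⌈m/6⌉<m : ∀ m → 2 ≤ m → ⌈ m /6⌉ < m
    ⌈m/6⌉<m m 2≤m = m<n*o⇒m/o<n (begin-strict
      m + 5        <⟨ +-monoʳ-< m (≤ᵇ⇒≤ 6 10 _) ⟩
      m + 5 * 2    ≤⟨ +-monoʳ-≤ m (*-monoʳ-≤ 5 2≤m) ⟩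
      6 * m        ≡⟨ *-comm 6 m ⟩
      m * 6        ∎)
    exponent : ∀ m → m₀ ≤ m → 40 * m + (b * ⌈ m /6⌉ + K) ≤ b * m + K
    exponent m m₀≤m = begin
      40 * m + (b * ⌈ m /6⌉ + K)              ≡⟨ +-assoc (40 * m) _ K ⟨
      40 * m + b * ⌈ m /6⌉ + K                ≤⟨ +-monoˡ-≤ K (+-monoʳ-≤ (40 * m) (*-cancelʳ-≤ _ _ 6 (begin
        b * ⌈ m /6⌉ * 6      ≡⟨ *-assoc b ⌈ m /6⌉ 6 ⟩
        b * (⌈ m /6⌉ * 6)    ≤⟨ *-monoʳ-≤ b (⌈m/6⌉*6≤m+5 m) ⟩
        b * (m + 5)          ≤⟨ slope m m₀≤m ⟩
        (b ∸ 40) * m * 6     ∎))) ⟩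
      40 * m + (b ∸ 40) * m + K               ≡⟨ cong (_+ K) (*-distribʳ-+ m 40 (b ∸ 40)) ⟨
      (40 + (b ∸ 40)) * m + K                 ≡⟨ cong (λ k → k * m + K) (m+[n∸m]≡n 40≤b) ⟩
      b * m + K                               ∎
    step : ∀ m → (∀ {c} → c < m → c * 30 ≤ N → Ψ (c * 30) ≤ 2 ^ (b * c + K)) → m * 30 ≤ N → Ψ (m * 30) ≤ 2 ^ (b * m + K)
    step m rec 30m≤N = case m <? m₀ of λ where
      (yes m<m₀) → initial m m<m₀ 30m≤N
      (no m≮m₀)  → let m₀≤m = ≮⇒≥ m≮m₀
                       c<m = ⌈m/6⌉<m m (≤-trans 2≤m₀ m₀≤m) in begin
        Ψ (m * 30)                              ≤⟨ Ψ-descent′ m 30m≤N ⟩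
        2 ^ (40 * m) * Ψ (⌈ m /6⌉ * 30)         ≤⟨ *-monoʳ-≤ (2 ^ (40 * m)) (rec c<m (≤-trans (*-monoˡ-≤ 30 (<⇒≤ c<m)) 30m≤N)) ⟩
        2 ^ (40 * m) * 2 ^ (b * ⌈ m /6⌉ + K)    ≡⟨ ^-distribˡ-+-* 2 (40 * m) _ ⟨
        2 ^ (40 * m + (b * ⌈ m /6⌉ + K))        ≤⟨ ^-monoʳ-≤ 2 (exponent m m₀≤m) ⟩
        2 ^ (b * m + K)                         ∎

  -- A crude bound that supplies the initial cases of the next one. Slope 80 propagates from m = 3
  -- on; for m < 3 the descent ends at or below 10, and `Ψ 10` gives the constant 22.
  Ψ≤2^80m : 10 ≤ N → ∀ m → m * 30 ≤ N → Ψ (m * 30) ≤ 2 ^ (80 * m + 22)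
  Ψ≤2^80m 10≤N = Ψ-linear 3 80 22 (≤ᵇ⇒≤ 2 3 _) slope (≤ᵇ⇒≤ 40 80 _) initial
    where
    slope : ∀ m → 3 ≤ m → 80 * (m + 5) ≤ 40 * m * 6
    slope m 3≤m = begin
      80 * (m + 5)         ≡⟨ *-distribˡ-+ 80 m 5 ⟩
      80 * m + 400         ≤⟨ +-monoʳ-≤ (80 * m) (≤ᵇ⇒≤ 400 (160 * 3) _) ⟩
      80 * m + 160 * 3     ≤⟨ +-monoʳ-≤ (80 * m) (*-monoʳ-≤ 160 3≤m) ⟩
      80 * m + 160 * m     ≡⟨ *-distribʳ-+ m 80 160 ⟨
      240 * m              ≡⟨ *-assoc 6 40 m ⟩
      6 * (40 * m)         ≡⟨ *-comm 6 (40 * m) ⟩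
      40 * m * 6           ∎
    initial : ∀ m → m < 3 → m * 30 ≤ N → Ψ (m * 30) ≤ 2 ^ (80 * m + 22)
    initial m m<3 30m≤N = begin
      Ψ (m * 30)                  ≤⟨ Ψ-descent m 30m≤N ⟩
      2 ^ (40 * m) * Ψ (m * 5)    ≤⟨ *-monoʳ-≤ (2 ^ (40 * m)) (≤-trans (Ψ-mono (*-monoˡ-≤ 5 (s≤s⁻¹ m<3))) (Ψ10≤2^22 10≤N)) ⟩
      2 ^ (40 * m) * 2 ^ 22       ≡⟨ ^-distribˡ-+-* 2 (40 * m) 22 ⟨
      2 ^ (40 * m + 22)           ≤⟨ ^-monoʳ-≤ 2 (+-monoˡ-≤ 22 (*-monoˡ-≤ m (≤ᵇ⇒≤ 40 80 _))) ⟩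
      2 ^ (80 * m + 22)           ∎

  -- Slope 49 propagates once 49 (m + 5) ≤ 54 m, that is m ≥ 49. Below that the slope 80 exceeds it
  -- by at most 31 · 48, whence 1510 = 31 · 48 + 22.
  Ψ≤2^49m : 10 ≤ N → ∀ m → m * 30 ≤ N → Ψ (m * 30) ≤ 2 ^ (49 * m + 1510)
  Ψ≤2^49m 10≤N = Ψ-linear 49 49 1510 (≤ᵇ⇒≤ 2 49 _) slope (≤ᵇ⇒≤ 40 49 _) initial
    where
    slope : ∀ m → 49 ≤ m → 49 * (m + 5) ≤ 9 * m * 6
    slope m 49≤m = begin
      49 * (m + 5)         ≡⟨ *-distribˡ-+ 49 m 5 ⟩
      49 * m + 5 * 49      ≤⟨ +-monoʳ-≤ (49 * m) (*-monoʳ-≤ 5 49≤m) ⟩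
      49 * m + 5 * m       ≡⟨ lemma m ⟩
      9 * m * 6            ∎
      where
      lemma : ∀ m → 49 * m + 5 * m ≡ 9 * m * 6
      lemma = solve-∀
    initial : ∀ m → m < 49 → m * 30 ≤ N → Ψ (m * 30) ≤ 2 ^ (49 * m + 1510)
    initial m m<49 30m≤N = ≤-trans (Ψ≤2^80m 10≤N m 30m≤N) (^-monoʳ-≤ 2 (begin
      80 * m + 22              ≡⟨ cong (_+ 22) (*-distribʳ-+ m 49 31) ⟩
      49 * m + 31 * m + 22     ≤⟨ +-monoˡ-≤ 22 (+-monoʳ-≤ (49 * m) (*-monoʳ-≤ 31 (s≤s⁻¹ m<49))) ⟩
      49 * m + 31 * 48 + 22    ≡⟨ +-assoc (49 * m) (31 * 48) 22 ⟩
      49 * m + 1510            ∎))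

-- Small n

-- The divisors tried are 2 to k + 1, as `(2 + k) Rough n` requires.
noDivisor : ℕ → ℕ → Bool
noDivisor n zero    = true
noDivisor n (suc k) = not (n % (2 + k) ≡ᵇ 0) ∧ noDivisor n k

T-∧⁻ : ∀ {x y} → T (x ∧ y) → T x × T y
T-∧⁻ = Equivalence.to T-∧

noDivisor⇒rough : ∀ n k → T (noDivisor n k) → (2 + k) Rough n
noDivisor⇒rough n zero    _  = 2-rough
noDivisor⇒rough n (suc k) ok = let h , t = T-∧⁻ ok in ∤⇒rough-suc (indivisible h) (noDivisor⇒rough n k t)
  where
  indivisible : T (not (n % (2 + k) ≡ᵇ 0)) → 2 + k ∤ n
  indivisible h d∣n = subst (λ r → T (not (r ≡ᵇ 0))) (n∣m⇒m%n≡0 n (2 + k) d∣n) h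

-- Trial division by 2 .. 708 suffices below 709 ² = 502681.
primeᵇ : ℕ → Bool
primeᵇ p = (1 <ᵇ p) ∧ (p <ᵇ 2+k * 2+k) ∧ noDivisor p k
  where
  -- For small `p` the trial stops at p - 1, before `p` divides itself.
  k = (p ∸ 2) ⊓ 707
  2+k = 2 + k

primeᵇ⇒prime : ∀ p → T (primeᵇ p) → Prime p
primeᵇ⇒prime p ok = let 1<p , ok′ = T-∧⁻ ok ; p<k² , nd = T-∧⁻ ok′ in
  rough∧square>⇒prime {{n>1⇒nonTrivial (<ᵇ⇒< 1 p 1<p)}} (noDivisor⇒rough p ((p ∸ 2) ⊓ 707) nd) (<ᵇ⇒< p _ p<k²)

-- In the ladder a prime p serves all n with lo ≤ n < ⌈ p / 4 ⌉.
ladder : ℕ → List ℕ → ℕ → Bool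
ladder lo []       hi = hi ≤ᵇ lo
ladder lo (p ∷ ps) hi = (p <ᵇ 5 * lo) ∧ primeᵇ p ∧ ladder ((p + 3) / 4) ps hi

-- If n < ⌈p/4⌉, then 4 (n + 1) ≤ p + 3 gives 4 n < p, while p < 5 lo ≤ 5 n. Otherwise ⌈p/4⌉ is the
-- new lower end.
ladder⇒prime : ∀ lo ps hi → T (ladder lo ps hi) → ∀ n → lo ≤ n → n < hi →
               ∃ λ p → Prime p × 4 * n < p × p < 5 * n
ladder⇒prime lo []       hi ok n lo≤n n<hi = contradiction (≤-trans (≤ᵇ⇒≤ hi lo ok) lo≤n) (<⇒≱ n<hi)
ladder⇒prime lo (p ∷ ps) hi ok n lo≤n n<hi with T-∧⁻ {p <ᵇ 5 * lo} ok
... | p<5lo , ok′ with T-∧⁻ {primeᵇ p} ok′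
... | pp , ok″ = select (n <? (p + 3) / 4)
  where
  open ≤-Reasoning
  4n<p : n < (p + 3) / 4 → 4 * n < p
  4n<p n< = +-cancelʳ-≤ 3 (suc (4 * n)) p (begin
    suc (4 * n) + 3        ≡⟨ cong suc (+-comm (4 * n) 3) ⟩
    4 + 4 * n              ≡⟨ *-suc 4 n ⟨
    4 * suc n              ≡⟨ *-comm 4 (suc n) ⟩
    suc n * 4              ≤⟨ *-monoˡ-≤ 4 n< ⟩
    (p + 3) / 4 * 4        ≤⟨ m/n*n≤m (p + 3) 4 ⟩
    p + 3                  ∎)
  select : Dec (n < (p + 3) / 4) → ∃ λ p → Prime p × 4 * n < p × p < 5 * n
  select (yes n<) = p , primeᵇ⇒prime p pp , 4n<p n< , <-≤-trans (<ᵇ⇒< p (5 * lo) p<5lo) (*-monoʳ-≤ 5 lo≤n)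
  select (no n≮)  = ladder⇒prime ((p + 3) / 4) ps hi ok″ n (≮⇒≥ n≮) n<hi

prime-below-100000 : ∀ n → 3 ≤ n → n < 100000 → ∃ λ p → Prime p × 4 * n < p × p < 5 * n
prime-below-100000 = ladder⇒prime 3
  -- Each prime lies just below 5 times the lower end left by its predecessor; the last gives
  -- ⌈492523/4⌉ = 123131 ≥ 100000.
  (13 ∷ 19 ∷ 23 ∷ 29 ∷ 37 ∷ 47 ∷ 59 ∷ 73 ∷ 89 ∷ 113 ∷ 139 ∷ 173 ∷ 211 ∷ 263 ∷ 317 ∷ 397 ∷
   499 ∷ 619 ∷ 773 ∷ 967 ∷ 1201 ∷ 1499 ∷ 1873 ∷ 2341 ∷ 2927 ∷ 3659 ∷ 4567 ∷ 5701 ∷ 7129 ∷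
   8893 ∷ 11119 ∷ 13883 ∷ 17351 ∷ 21683 ∷ 27103 ∷ 33871 ∷ 42337 ∷ 52919 ∷ 66137 ∷ 82657 ∷
   103319 ∷ 129127 ∷ 161407 ∷ 201757 ∷ 252193 ∷ 315223 ∷ 394019 ∷ 492523 ∷ [])
  100000 _

-- Large n

sqrt : ∀ n → ∃ λ s → s * s ≤ n × n < suc s * suc s
sqrt zero    = 0 , z≤n , s≤s z≤n
sqrt (suc n) with sqrt n
... | s , s²≤n , n<[1+s]² with suc n <? suc s * suc s
...   | yes 1+n<[1+s]² = s , m≤n⇒m≤1+n s²≤n , 1+n<[1+s]²
...   | no  1+n≮[1+s]² = suc s , ≮⇒≥ 1+n≮[1+s]² , ≤-<-trans n<[1+s]² (*-mono-< (n<1+n (suc s)) (n<1+n (suc s)))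

-- A linear substitute for the binary logarithm: with q = ⌊m/2ᵏ⌋, m < (q + 1) 2ᵏ and q + 1 ≤ 2 ^ q.
m<2^[k+m/2^k] : ∀ k m → m < 2 ^ (k + _/_ m (2 ^ k) {{m^n≢0 2 k}})
m<2^[k+m/2^k] k m = begin-strict
  m                              ≡⟨ m≡m%n+[m/n]*n m (2 ^ k) ⟩
  m % 2 ^ k + m / 2 ^ k * 2 ^ k  <⟨ +-monoˡ-< (m / 2 ^ k * 2 ^ k) (m%n<n m (2 ^ k)) ⟩
  suc (m / 2 ^ k) * 2 ^ k        ≤⟨ *-monoˡ-≤ (2 ^ k) (n<m^n (m / 2 ^ k) (s≤s (s≤s z≤n))) ⟩
  2 ^ (m / 2 ^ k) * 2 ^ k        ≡⟨ *-comm (2 ^ (m / 2 ^ k)) (2 ^ k) ⟩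
  2 ^ k * 2 ^ (m / 2 ^ k)        ≡⟨ ^-distribˡ-+-* 2 k (m / 2 ^ k) ⟨
  2 ^ (k + m / 2 ^ k)            ∎
  where
  open ≤-Reasoning
  instance _ = m^n≢0 2 k

2^-cancel-≤ : ∀ {m n} → 2 ^ m ≤ 2 ^ n → m ≤ n
2^-cancel-≤ 2ᵐ≤2ⁿ = ≮⇒≥ λ n<m → <⇒≱ (^-monoʳ-< 2 (s≤s (s≤s z≤n)) n<m) 2ᵐ≤2ⁿ

-- The slope `a * s₀` available from `s₀` on is split into `b` for the linear term and a reserve `k`
-- that outweighs the constant.
linear<quadratic : ∀ a b c k {s₀ s} → s₀ ≤ s → b + k ≤ a * s₀ → c < k * s₀ → b * s + c < a * (s * s)
linear<quadratic a b c k {s₀} {s} s₀≤s b+k≤as₀ c<ks₀ = begin-strict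
  b * s + c          <⟨ +-monoʳ-< (b * s) c<ks₀ ⟩
  b * s + k * s₀     ≤⟨ +-monoʳ-≤ (b * s) (*-monoʳ-≤ k s₀≤s) ⟩
  b * s + k * s      ≡⟨ *-distribʳ-+ s b k ⟨
  (b + k) * s        ≤⟨ *-monoˡ-≤ s (≤-trans b+k≤as₀ (*-monoʳ-≤ a s₀≤s)) ⟩
  a * s * s          ≡⟨ *-assoc a s s ⟩
  a * (s * s)        ∎
  where open ≤-Reasoning

-- The constants are kept as variables, so that no numeral is ever unfolded.
growth : ∀ a B D E K k {s₀} t s y → y * (a + D) ≤ s → s * s ≤ D * 3 * t + E → s₀ ≤ s →
         D * ((a + D) * B + 2) + k ≤ a * s₀ →
         D * ((a + D) * B * 2 + (a + D) * K) + (a + D) * E < k * s₀ →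
         (B + y) * (s + 2) + K < 3 * t
growth a B D E K k {s₀} t s y yA≤s s²≤ s₀≤s slope const = ≰⇒> λ 3t≤ →
  -- Multiplying the negated claim by `A = a + D` and using `y * A ≤ s` bounds A s² by D s² plus
  -- linear terms; cancelling D s² leaves a s² against b s + c.
  <⇒≱ (linear<quadratic a b c k s₀≤s slope const) (+-cancelˡ-≤ (D * (s * s)) _ _ (begin
    D * (s * s) + a * (s * s)                              ≡⟨ trans (+-comm (D * (s * s)) _) (sym (*-distribʳ-+ (s * s) a D)) ⟩
    A * (s * s)                                            ≤⟨ *-monoʳ-≤ A s²≤ ⟩
    A * (D * 3 * t + E)                                    ≡⟨ lemma₁ A D E t ⟩
    D * (A * (3 * t)) + A * E                              ≤⟨ +-monoˡ-≤ (A * E) (*-monoʳ-≤ D (*-monoʳ-≤ A 3t≤)) ⟩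
    D * (A * ((B + y) * (s + 2) + K)) + A * E              ≡⟨ cong (λ x → D * x + A * E) (lemma₂ A B K s y) ⟩
    D * (A * B * (s + 2) + y * A * (s + 2) + A * K) + A * E ≤⟨ +-monoˡ-≤ (A * E) (*-monoʳ-≤ D (+-monoˡ-≤ (A * K)
      (+-monoʳ-≤ (A * B * (s + 2)) (*-monoˡ-≤ (s + 2) yA≤s)))) ⟩
    D * (A * B * (s + 2) + s * (s + 2) + A * K) + A * E    ≡⟨ lemma₃ A B D E K s ⟩
    D * (s * s) + (b * s + c)                              ∎))
  where
  open ≤-Reasoning
  A = a + D
  b = D * (A * B + 2)
  c = D * (A * B * 2 + A * K) + A * E
  lemma₁ : ∀ A D E t → A * (D * 3 * t + E) ≡ D * (A * (3 * t)) + A * E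
  lemma₁ = solve-∀
  lemma₂ : ∀ A B K s y → A * ((B + y) * (s + 2) + K) ≡ A * B * (s + 2) + y * A * (s + 2) + A * K
  lemma₂ = solve-∀
  lemma₃ : ∀ A B D E K s → D * (A * B * (s + 2) + s * (s + 2) + A * K) + A * E ≡
                           D * (s * s) + (D * (A * B + 2) * s + (D * (A * B * 2 + A * K) + A * E))
  lemma₃ = solve-∀

-- Excludes the endpoint, since the assumption to be refuted concerns only primes strictly below
-- `5 * n`.
¬prime[5*n] : ∀ {n} → 1 < n → ¬ Prime (5 * n)
¬prime[5*n] {n} 1<n p with prime⇒irreducible p (m∣m*n {5} n)
... | inj₂ 5≡5n = <⇒≢ 1<n (*-cancelˡ-≡ 1 n 5 5≡5n)

module _ (n : ℕ) (100000≤n : 100000 ≤ n) (no-prime : ∀ {p} → Prime p → 4 * n < p → ¬ p < 5 * n) where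
  open Chebyshev (5 * n)
  open Estimates (5 * n)
  open ≤-Reasoning

  primeless : ∀ {p} → Prime p → p ≤ 5 * n → p ≤ 4 * n
  primeless {p} pp p≤5n = ≮⇒≥ λ 4n<p → no-prime pp 4n<p (≤∧≢⇒< p≤5n λ where
    refl → ¬prime[5*n] (≤-trans (≤ᵇ⇒≤ 2 100000 _) 100000≤n) pp)

  r t : ℕ
  r = n % 30
  t = n / 30

  [c*d]t≤cn : ∀ c → c * 30 * t ≤ c * n
  [c*d]t≤cn c = begin
    c * 30 * t     ≡⟨ *-assoc c 30 t ⟩
    c * (30 * t)   ≡⟨ cong (c *_) (*-comm 30 t) ⟩
    c * (t * 30)   ≤⟨ *-monoʳ-≤ c (m/n*n≤m n 30) ⟩
    c * n          ∎

  cn≤ : ∀ c → c * n ≤ c * 30 * t + c * 29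
  cn≤ c = begin
    c * n                  ≡⟨ cong (c *_) (m≡m%n+[m/n]*n n 30) ⟩
    c * (r + t * 30)       ≤⟨ *-monoʳ-≤ c (+-monoˡ-≤ (t * 30) (s≤s⁻¹ (m%n<n n 30))) ⟩
    c * (29 + t * 30)      ≡⟨ lemma c 29 t 30 ⟩
    c * 30 * t + c * 29    ∎
    where
    lemma : ∀ c e t d → c * (e + t * d) ≡ c * d * t + c * e
    lemma = solve-∀

  3333≤t : 3333 ≤ t
  3333≤t = ≤-trans (≤ᵇ⇒≤ 3333 (100000 / 30) _) (/-monoˡ-≤ 30 100000≤n)

  10≤5n : 10 ≤ 5 * n
  10≤5n = ≤-trans (≤-trans (≤ᵇ⇒≤ 10 100000 _) 100000≤n) (m≤n*m n 5)

  -- Rounds 4 n up to 120 (t + 1), still at most 5 n. The constants are 196 = 49 · 4 and 1706 = 196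
  -- + 1510.
  Ψ[4n]≤ : Ψ (4 * n) ≤ 2 ^ (196 * t + 1706)
  Ψ[4n]≤ = begin
    Ψ (4 * n)                       ≤⟨ Ψ-mono 4n≤ ⟩
    Ψ (4 * suc t * 30)              ≤⟨ Ψ≤2^49m 10≤5n (4 * suc t) ≤5n ⟩
    2 ^ (49 * (4 * suc t) + 1510)   ≡⟨ cong (λ x → 2 ^ (x + 1510)) (*-assoc 49 4 (suc t)) ⟨
    2 ^ (196 * suc t + 1510)        ≡⟨ cong (2 ^_) (trans (cong (_+ 1510) (trans (*-suc 196 t) (+-comm 196 (196 * t)))) (+-assoc (196 * t) 196 1510)) ⟩
    2 ^ (196 * t + 1706)            ∎
    where
    lemma : ∀ c t d → c * (1 + t) * d ≡ c * d * t + c * d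
    lemma = solve-∀
    4n≤ : 4 * n ≤ 4 * suc t * 30
    4n≤ = begin
      4 * n                   ≤⟨ cn≤ 4 ⟩
      4 * 30 * t + 4 * 29     ≤⟨ +-monoʳ-≤ (4 * 30 * t) (≤ᵇ⇒≤ (4 * 29) (4 * 30) _) ⟩
      4 * 30 * t + 4 * 30     ≡⟨ lemma 4 t 30 ⟨
      4 * suc t * 30          ∎
    ≤5n : 4 * suc t * 30 ≤ 5 * n
    ≤5n = begin
      4 * suc t * 30          ≡⟨ lemma 4 t 30 ⟩
      120 * t + 30 * 4        ≤⟨ +-monoʳ-≤ (120 * t) (*-monoʳ-≤ 30 (≤-trans (≤ᵇ⇒≤ 4 3333 _) 3333≤t)) ⟩
      120 * t + 30 * t        ≡⟨ *-distribʳ-+ t 120 30 ⟨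
      5 * 30 * t              ≤⟨ [c*d]t≤cn 5 ⟩
      5 * n                   ∎

  -- Rounds 5 n down to 30 · 5 t, where the lower bound for Ψ applies.
  2^199t≤ : 2 ^ (199 * t) ≤ (5 * n + 1) * Ψ (5 * n)
  2^199t≤ = begin
    2 ^ (199 * t)                              ≡⟨ ^-*-assoc 2 199 t ⟨
    (2 ^ 199) ^ t                              ≤⟨ ^-monoˡ-≤ t 2^199≤α^5 ⟩
    (α ^ 5) ^ t                                ≡⟨ ^-*-assoc α 5 t ⟩
    α ^ (5 * t)                                ≤⟨ α^m≤Ψ (5 * t) 150t≤5n ⟩
    (5 * t * 30 + 1) * Ψ (5 * t * 30)          ≤⟨ *-mono-≤ (+-monoˡ-≤ 1 150t≤5n) (Ψ-mono 150t≤5n) ⟩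
    (5 * n + 1) * Ψ (5 * n)                    ∎
    where
    lemma : ∀ c t d → c * t * d ≡ c * d * t
    lemma = solve-∀
    150t≤5n : 5 * t * 30 ≤ 5 * n
    150t≤5n = ≤-trans (≤-reflexive (lemma 5 t 30)) ([c*d]t≤cn 5)

  contradictory : ⊥
  contradictory with sqrt (5 * n)
  ... | s , s²≤5n , 5n<[1+s]² = <⇒≱ upper-bound lower-bound
    where
    700≤s : 700 ≤ s
    700≤s = ≮⇒≥ λ s<700 → <⇒≱ 5n<[1+s]² (begin
      suc s * suc s       ≤⟨ *-mono-≤ s<700 s<700 ⟩
      700 * 700           ≤⟨ ≤ᵇ⇒≤ (700 * 700) (5 * 100000) _ ⟩
      5 * 100000          ≤⟨ *-monoʳ-≤ 5 100000≤n ⟩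
      5 * n               ∎)
    -- `L` is the linear substitute for the binary logarithm of `suc s`, with block size 1024.
    y L : ℕ
    y = s / 2 ^ 10
    L = 10 + y
    1+s≤2^L : suc s ≤ 2 ^ L
    1+s≤2^L = m<2^[k+m/2^k] 10 s
    upper-bound : L * (s + 2) + 1706 < 3 * t
    -- Here 974 + 50 = 1024, and 5 n ≤ 50 · 3 t + 145. The reserve 169700 is exactly 974 · 700 - 50
    -- · (1024 · 10 + 2).
    upper-bound = growth 974 10 50 145 1706 169700 {700} t s y (m/n*n≤m s (2 ^ 10)) (≤-trans s²≤5n (cn≤ 5)) 700≤s
      (≤ᵇ⇒≤ (50 * (1024 * 10 + 2) + 169700) (974 * 700) _)
      (<ᵇ⇒< (50 * (1024 * 10 * 2 + 1024 * 1706) + 1024 * 145) (169700 * 700) _)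
    q≤s : ∀ q → q * q ≤ 5 * n → q ≤ s
    q≤s q q²≤5n = ≮⇒≥ λ s<q → <⇒≱ 5n<[1+s]² (≤-trans (*-mono-≤ s<q s<q) q²≤5n)
    instance
      s≢0 : NonZero s
      s≢0 = >-nonZero (≤-trans (≤ᵇ⇒≤ 1 700 _) 700≤s)
    exponents : ∀ L s K t′ → L + L + (t′ + K + L * s) ≡ t′ + (L * (s + 2) + K)
    exponents = solve-∀
    5n≤2*4n : 5 * n ≤ 2 * (4 * n)
    5n≤2*4n = ≤-trans (*-monoˡ-≤ n (≤ᵇ⇒≤ 5 8 _)) (≤-reflexive (*-assoc 2 4 n))
    lower-bound : 3 * t ≤ L * (s + 2) + 1706
    lower-bound = +-cancelˡ-≤ (196 * t) _ _ (≤-trans (≤-reflexive (sym (*-distribʳ-+ t 196 3))) (2^-cancel-≤ (begin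
      -- All factors are turned into powers of 2: 5 n + 1 ≤ (s + 1)² ≤ 2 ^ (2 L), and s ^ s ≤ 2 ^ (L
      -- s).
      2 ^ (199 * t)                                   ≤⟨ 2^199t≤ ⟩
      (5 * n + 1) * Ψ (5 * n)                         ≤⟨ *-mono-≤ (≤-trans (≤-reflexive (+-comm (5 * n) 1)) 5n<[1+s]²)
        (Ψ-primeless (5 * n) (4 * n) s 5n≤2*4n q≤s primeless) ⟩
      suc s * suc s * (Ψ (4 * n) * s ^ s)             ≤⟨ *-mono-≤ (*-mono-≤ 1+s≤2^L 1+s≤2^L)
        (*-mono-≤ Ψ[4n]≤ (^-monoˡ-≤ s (<⇒≤ 1+s≤2^L))) ⟩
      2 ^ L * 2 ^ L * (2 ^ (196 * t + 1706) * (2 ^ L) ^ s)  ≡⟨ cong₂ _*_ (^-distribˡ-+-* 2 L L) (trans (^-distribˡ-+-* 2 (196 * t + 1706) (L * s))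
        (cong (2 ^ (196 * t + 1706) *_) (sym (^-*-assoc 2 L s)))) ⟨
      2 ^ (L + L) * 2 ^ (196 * t + 1706 + L * s)      ≡⟨ ^-distribˡ-+-* 2 (L + L) _ ⟨
      2 ^ (L + L + (196 * t + 1706 + L * s))          ≡⟨ cong (2 ^_) (exponents L s 1706 (196 * t)) ⟩
      2 ^ (196 * t + (L * (s + 2) + 1706))            ∎)))

theorem2p1p3 : ∀ (n : ℕ) → n > 2 → ∃ λ (p : ℕ) → Prime p × (4 * n < p) × (p < 5 * n)
theorem2p1p3 n n>2 with n <? 100000
... | yes n<100000 = prime-below-100000 n n>2 n<100000
-- The search below `5 * n` is finite, so its failure yields the assumption refuted by
-- `contradictory`.
... | no  n≮100000 with anyUpTo? (λ p → prime? p ×-dec (4 * n <? p)) (5 * n)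
...   | yes (p , p<5n , pp , 4n<p) = p , pp , 4n<p , p<5n
...   | no  none = ⊥-elim (contradictory n (≮⇒≥ n≮100000) λ {p} pp 4n<p p<5n → none (p , p<5n , pp , 4n<p))
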